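{- Let $k\ge 1$ be an integer and let $S_{2k}=K_{1,2k-1}$ be the star graph on $2k$ vertices. Then the $k$-token graph $F_k(S_{2k})$ is isomorphic to the double odd graph $2O_k$.
   Context: All graphs are finite and simple. For a graph $G$ on $n$ vertices and $1\le k\le n$, the $k$-token graph $F_k(G)$ has as vertices the $k$-subsets of $V(G)$; two vertices $A,B$ are adjacent iff $A\bigtriangleup B=\{a,b\}$ with $a\in A$, $b\in B$ and $\{a,b\}$ an edge of $G$. The double odd graph $2O_k$ is the graph whose vertices are the $(k-1)$-subsets and the $k$-subsets of $[2k-1]=\{1,\dots,2k-1\}$, where distinct vertices $\gamma,\delta$ are adjacent iff $\gamma\subset\delta$ or $\delta\subset\gamma$. -}

module Defs where

open import Data.Nat using (ℕ; _+_; _*_; _∸_; _≤_; _<_)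
open import Data.Nat.Properties using (<⇒≱)
open import Data.Fin using (Fin; toℕ)
open import Data.Fin.Subset using (Subset; inside; outside; _∈_; _⊂_; _∪_; _─_; ⁅_⁆; ∣_∣)
open import Data.Fin.Subset.Properties using (∪-comm; x∈⁅x⁆; x∈p∪q⁺; x∈p∪q⁻)
open import Data.Product using (Σ; ∃₂; _×_; _,_; proj₁)
open import Data.Sum using (_⊎_; inj₁; inj₂; swap)
open import Data.Vec using (_∷_; there)
open import Function.Bundles using (_↔_; _⇔_; Inverse)
open import Relation.Nullary using (¬_)
open import Relation.Binary.PropositionalEquality using (_≡_; refl; sym; trans; subst)

record SimpleGraph (V : Set) : Set₁ where
  field
    Adj         : V → V → Set
    Adj-sym     : ∀ {u v} → Adj u v → Adj v u
    Adj-irrefl  : ∀ {v} → ¬ Adj v v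

open SimpleGraph public

infix 4 _≅_

record _≅_ {V W : Set} (G : SimpleGraph V) (H : SimpleGraph W) : Set where
  field
    vertices  : V ↔ W
    adjacency : ∀ u v → Adj G u v ⇔ Adj H (Inverse.to vertices u) (Inverse.to vertices v)

-- The first m elements of Fin (m + n) form one part, the last n the other.
completeBipartite : ∀ m n → SimpleGraph (Fin (m + n))
completeBipartite m n = record
  { Adj        = λ i j → (toℕ i < m × m ≤ toℕ j) ⊎ (toℕ j < m × m ≤ toℕ i)
  ; Adj-sym    = swap
  ; Adj-irrefl = λ { (inj₁ (i<m , m≤i)) → <⇒≱ i<m m≤i
                   ; (inj₂ (i<m , m≤i)) → <⇒≱ i<m m≤i }
  }

infixl 6 _△_

_△_ : ∀ {n} → Subset n → Subset n → Subset n
A △ B = (A ─ B) ∪ (B ─ A)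

△-comm : ∀ {n} (A B : Subset n) → A △ B ≡ B △ A
△-comm A B = ∪-comm (A ─ B) (B ─ A)

x∉A─A : ∀ {n} (A : Subset n) {x : Fin n} → ¬ (x ∈ A ─ A)
x∉A─A (inside  ∷ A) (there x∈) = x∉A─A A x∈
x∉A─A (outside ∷ A) (there x∈) = x∉A─A A x∈

x∉A△A : ∀ {n} (A : Subset n) {x : Fin n} → ¬ (x ∈ A △ A)
x∉A△A A x∈ with x∈p∪q⁻ (A ─ A) (A ─ A) x∈
... | inj₁ x∈′ = x∉A─A A x∈′
... | inj₂ x∈′ = x∉A─A A x∈′

KSubset : ℕ → ℕ → Set
KSubset n k = Σ (Subset n) λ A → ∣ A ∣ ≡ k

tokenGraph : ∀ {n} (k : ℕ) → SimpleGraph (Fin n) → SimpleGraph (KSubset n k)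
tokenGraph {n} k G = record
  { Adj        = λ A B → TokenAdj (proj₁ A) (proj₁ B)
  ; Adj-sym    = λ { {A , _} {B , _} (a , b , a∈A , b∈B , A△B≡ab , ab) →
                     b , a , b∈B , a∈A
                     , trans (△-comm B A) (trans A△B≡ab (∪-comm ⁅ a ⁆ ⁅ b ⁆))
                     , Adj-sym G ab }
  ; Adj-irrefl = λ { {A , _} (a , b , _ , _ , A△A≡ab , _) →
                     x∉A△A A (subst (a ∈_) (sym A△A≡ab) (x∈p∪q⁺ (inj₁ (x∈⁅x⁆ a)))) }
  }
  where
  TokenAdj : Subset n → Subset n → Set
  TokenAdj A B = ∃₂ λ a b →
    a ∈ A × b ∈ B × A △ B ≡ ⁅ a ⁆ ∪ ⁅ b ⁆ × Adj G a b

-- Intended for k ≥ 1; at k = 0 truncated subtraction makes the two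
-- cardinality conditions coincide.
DoubleOddVertex : ℕ → Set
DoubleOddVertex k =
  Σ (Subset (2 * k ∸ 1)) λ γ → ∣ γ ∣ ≡ k ∸ 1 ⊎ ∣ γ ∣ ≡ k

-- _⊂_ is strict inclusion, so adjacent vertices are automatically distinct.
doubleOddGraph : (k : ℕ) → SimpleGraph (DoubleOddVertex k)
doubleOddGraph k = record
  { Adj        = λ (γ , _) (δ , _) → γ ⊂ δ ⊎ δ ⊂ γ
  ; Adj-sym    = swap
  ; Adj-irrefl = λ { (inj₁ (_ , _ , x∈ , x∉)) → x∉ x∈
                   ; (inj₂ (_ , _ , x∈ , x∉)) → x∉ x∈ }
  }

{-# OPTIONS --safe #-}
-- Deleting the centre of the star from a k-subset A leaves a (k-1)-subset of the leaves
-- if A contains the centre, and a k-subset otherwise. Every edge of a star contains the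
-- centre, so a token move exchanges the centre with a leaf, which on the leaves inserts
-- or removes one element; by cardinality such moves are exactly the strict inclusions
-- between the two layers.
module Submission where

open import Defs
open import Data.Nat using (ℕ; suc; _*_; _∸_; _≤_; _<_; z≤n; s≤s)
open import Data.Nat.Properties using (suc-injective; ≡-irrelevant; <-irrefl; <-asym; n<1+n; module ≤-Reasoning)
open import Data.Fin using (Fin; zero; suc; _≟_)
open import Data.Fin.Subset using (Subset; inside; outside; _∈_; _∉_; _⊆_; _⊂_; _∪_; _─_; _-_; ⁅_⁆; ∣_∣)
open import Data.Fin.Subset.Properties
open import Data.Product using (Σ; _,_; proj₁)
open import Data.Sum using (_⊎_; inj₁; inj₂; swap)
open import Data.Vec using (_∷_; here; there; tail)
open import Function using (_∘_)
open import Function.Bundles using (_↔_; _⇔_; mk↔ₛ′; mk⇔; Equivalence)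
open import Relation.Nullary using (¬_; yes; no; contradiction)
open import Relation.Binary.PropositionalEquality using (_≡_; refl; sym; trans; cong; subst)

private
  variable
    n j : ℕ

x∈p─q⇒x∉q : (p q : Subset n) {x : Fin n} → x ∈ p ─ q → x ∉ q
x∈p─q⇒x∉q (_ ∷ p) (_ ∷ q) (there x∈) (there x∈q) = x∈p─q⇒x∉q p q x∈ x∈q

-- An element of `γ` outside `δ` would lie in `γ △ δ`, hence be `b`, which is in `δ`. Strictness is
-- witnessed by `b`, since a common element of both sets lies in neither difference.
△≡⁅b⁆⇒⊂ : {γ δ : Subset n} {b : Fin n} → b ∈ δ → γ △ δ ≡ ⁅ b ⁆ → γ ⊂ δ
△≡⁅b⁆⇒⊂ {γ = γ} {δ} {b} b∈δ γ△δ≡b = γ⊆δ , b , b∈δ , b∉γ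
  where
  γ⊆δ : γ ⊆ δ
  γ⊆δ {x} x∈γ with x ∈? δ
  ... | yes x∈δ = x∈δ
  ... | no  x∉δ = subst (_∈ δ) (sym x≡b) b∈δ
    where
    x≡b : x ≡ b
    x≡b = x∈⁅y⁆⇒x≡y b (subst (x ∈_) γ△δ≡b (x∈p∪q⁺ (inj₁ (x∈p∧x∉q⇒x∈p─q x∈γ x∉δ))))

  b∉γ : b ∉ γ
  b∉γ b∈γ with x∈p∪q⁻ (γ ─ δ) (δ ─ γ) (subst (b ∈_) (sym γ△δ≡b) (x∈⁅x⁆ b))
  ... | inj₁ b∈γ─δ = x∈p─q⇒x∉q γ δ b∈γ─δ b∈δ
  ... | inj₂ b∈δ─γ = x∈p─q⇒x∉q δ γ b∈δ─γ b∈γ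

-- Turns an inclusion between the layers back into a token move: a size gap of one leaves room for a
-- single element of `δ` outside `γ`.
⊆∧∣δ∣≡1+∣γ∣⇒△≡⁅b⁆ : {γ δ : Subset n} {b : Fin n} → γ ⊆ δ → ∣ δ ∣ ≡ suc ∣ γ ∣ →
                    b ∈ δ → b ∉ γ → γ △ δ ≡ ⁅ b ⁆
⊆∧∣δ∣≡1+∣γ∣⇒△≡⁅b⁆ {γ = γ} {δ} {b} γ⊆δ ∣δ∣≡ b∈δ b∉γ = ⊆-antisym △⊆b b⊆△
  where
  -- A further element x of δ ─ γ would give γ ⊆ δ - b - x, which is too small.
  unique : ∀ {x} → x ∈ δ → x ∉ γ → x ≡ b
  unique {x} x∈δ x∉γ with x ≟ b
  ... | yes x≡b = x≡b
  ... | no  x≢b = contradiction absurd (<-irrefl refl)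
    where
    open ≤-Reasoning

    γ⊆δ-b-x : γ ⊆ δ - b - x
    γ⊆δ-b-x y∈γ = x∈p∧x≢y⇒x∈p-y
      (x∈p∧x≢y⇒x∈p-y (γ⊆δ y∈γ) λ { refl → b∉γ y∈γ })
      λ { refl → x∉γ y∈γ }

    ∣δ-b∣≤∣γ∣ : ∣ δ - b ∣ ≤ ∣ γ ∣
    ∣δ-b∣≤∣γ∣ with s≤s le ← subst (suc ∣ δ - b ∣ ≤_) ∣δ∣≡ (x∈p⇒∣p-x∣<∣p∣ b∈δ) = le

    absurd : ∣ γ ∣ < ∣ γ ∣
    absurd = begin-strict
      ∣ γ ∣         ≤⟨ p⊆q⇒∣p∣≤∣q∣ γ⊆δ-b-x ⟩
      ∣ δ - b - x ∣ <⟨ x∈p⇒∣p-x∣<∣p∣ (x∈p∧x≢y⇒x∈p-y x∈δ x≢b) ⟩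
      ∣ δ - b ∣     ≤⟨ ∣δ-b∣≤∣γ∣ ⟩
      ∣ γ ∣         ∎

  △⊆b : γ △ δ ⊆ ⁅ b ⁆
  △⊆b x∈ with x∈p∪q⁻ (γ ─ δ) (δ ─ γ) x∈
  ... | inj₁ x∈γ─δ = contradiction (γ⊆δ (p─q⊆p γ δ x∈γ─δ)) (x∈p─q⇒x∉q γ δ x∈γ─δ)
  ... | inj₂ x∈δ─γ = subst (_∈ ⁅ b ⁆) (sym (unique (p─q⊆p δ γ x∈δ─γ) (x∈p─q⇒x∉q δ γ x∈δ─γ))) (x∈⁅x⁆ b)

  b⊆△ : ⁅ b ⁆ ⊆ γ △ δ
  b⊆△ x∈b = subst (_∈ γ △ δ) (sym (x∈⁅y⁆⇒x≡y b x∈b)) (x∈p∪q⁺ (inj₂ (x∈p∧x∉q⇒x∈p─q b∈δ b∉γ)))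

starTokenGraph : ∀ n j → SimpleGraph (KSubset (suc n) (suc j))
starTokenGraph n j = tokenGraph (suc j) (completeBipartite 1 n)

Layers : ℕ → ℕ → Set
Layers n j = Σ (Subset n) λ γ → ∣ γ ∣ ≡ j ⊎ ∣ γ ∣ ≡ suc j

Comparable : Subset n → Subset n → Set
Comparable γ δ = γ ⊂ δ ⊎ δ ⊂ γ

deleteCentre : KSubset (suc n) (suc j) → Layers n j
deleteCentre (inside  ∷ γ , p) = γ , inj₁ (suc-injective p)
deleteCentre (outside ∷ γ , p) = γ , inj₂ p

restoreCentre : Layers n j → KSubset (suc n) (suc j)
restoreCentre (γ , inj₁ p) = inside  ∷ γ , cong suc p
restoreCentre (γ , inj₂ p) = outside ∷ γ , p

KSubset↔Layers : KSubset (suc n) (suc j) ↔ Layers n j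
KSubset↔Layers = mk↔ₛ′ deleteCentre restoreCentre
  -- `suc-injective` and `cong suc` need not cancel by computation; uniqueness of equality proofs in
  -- `ℕ` identifies the results.
  (λ { (γ , inj₁ p) → cong (λ q → γ , inj₁ q) (≡-irrelevant _ p)
     ; (γ , inj₂ p) → refl })
  (λ { (inside  ∷ γ , p) → cong (inside ∷ γ ,_) (≡-irrelevant _ p)
     ; (outside ∷ γ , p) → refl })

centre∈edge : {a b : Fin (suc n)} → Adj (completeBipartite 1 n) a b → zero ∈ ⁅ a ⁆ ∪ ⁅ b ⁆
centre∈edge {a = zero}  {b = b}     _               = x∈p∪q⁺ {p = ⁅ zero ⁆} {q = ⁅ b ⁆} (inj₁ here)
centre∈edge {a = suc a} {b = zero}  _               = x∈p∪q⁺ {p = ⁅ suc a ⁆} {q = ⁅ zero ⁆} (inj₂ here)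
centre∈edge {a = suc _} {b = suc _} (inj₁ (s≤s () , _))
centre∈edge {a = suc _} {b = suc _} (inj₂ (s≤s () , _))

move⇒centre∈△ : (A B : KSubset (suc n) (suc j)) → Adj (starTokenGraph n j) A B → zero ∈ proj₁ A △ proj₁ B
move⇒centre∈△ A B (_ , _ , _ , _ , A△B≡ab , ab) = subst (zero ∈_) (sym A△B≡ab) (centre∈edge ab)

equinumerous⇒¬Comparable : (γ δ : Subset n) → ∣ γ ∣ ≡ ∣ δ ∣ → ¬ Comparable γ δ
equinumerous⇒¬Comparable γ δ eq (inj₁ γ⊂δ) = <-irrefl eq (p⊂q⇒∣p∣<∣q∣ γ⊂δ)
equinumerous⇒¬Comparable γ δ eq (inj₂ δ⊂γ) = <-irrefl (sym eq) (p⊂q⇒∣p∣<∣q∣ δ⊂γ)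

-- The one case, up to symmetry, in which moves exist. Here `γ` has `j` elements and `δ` has
-- `suc j`, so only `γ ⊂ δ` can occur.
exchange⇔Comparable : (γ δ : Subset n) (p : suc ∣ γ ∣ ≡ suc j) (q : ∣ δ ∣ ≡ suc j) →
                      Adj (starTokenGraph n j) (inside ∷ γ , p) (outside ∷ δ , q) ⇔ Comparable γ δ
exchange⇔Comparable {n} {j} γ δ p q = mk⇔ to from
  where
  to : Adj (starTokenGraph n j) (inside ∷ γ , p) (outside ∷ δ , q) → Comparable γ δ
  -- The target set omits the centre, so `b` is a leaf and `a` must be the centre. Taking tails
  -- leaves `γ △ δ ≡ ⊥ ∪ ⁅ b ⁆`.
  to (zero , suc b , _ , there b∈δ , eq , _) =
    inj₁ (△≡⁅b⁆⇒⊂ b∈δ (trans (cong tail eq) (∪-identityˡ ⁅ b ⁆)))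
  to (suc _ , suc _ , _ , _ , _ , inj₁ (s≤s () , _))
  to (suc _ , suc _ , _ , _ , _ , inj₂ (s≤s () , _))

  ∣δ∣≡1+∣γ∣ : ∣ δ ∣ ≡ suc ∣ γ ∣
  ∣δ∣≡1+∣γ∣ = trans q (sym p)

  from : Comparable γ δ → Adj (starTokenGraph n j) (inside ∷ γ , p) (outside ∷ δ , q)
  -- The token on the centre moves to the leaf that witnesses strictness.
  from (inj₁ (γ⊆δ , b , b∈δ , b∉γ)) =
    zero , suc b , here , there b∈δ
    , cong (inside ∷_) (trans (⊆∧∣δ∣≡1+∣γ∣⇒△≡⁅b⁆ γ⊆δ ∣δ∣≡1+∣γ∣ b∈δ b∉γ) (sym (∪-identityˡ ⁅ b ⁆)))
    , inj₁ (s≤s z≤n , s≤s z≤n)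
  from (inj₂ δ⊂γ) =
    contradiction (subst (∣ γ ∣ <_) (sym ∣δ∣≡1+∣γ∣) (n<1+n _)) (<-asym (p⊂q⇒∣p∣<∣q∣ δ⊂γ))

move⇔Comparable : (A B : KSubset (suc n) (suc j)) →
                  Adj (starTokenGraph n j) A B ⇔ Comparable (proj₁ (deleteCentre A)) (proj₁ (deleteCentre B))
move⇔Comparable A@(inside ∷ γ , p) B@(inside ∷ δ , q) = mk⇔
  -- `A` and `B` agree at the centre, so `zero` cannot lie in `A △ B`.
  (λ A~B → contradiction (move⇒centre∈△ A B A~B) λ ())
  (λ γ~δ → contradiction γ~δ (equinumerous⇒¬Comparable γ δ (suc-injective (trans p (sym q)))))
move⇔Comparable A@(outside ∷ γ , p) B@(outside ∷ δ , q) = mk⇔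
  (λ A~B → contradiction (move⇒centre∈△ A B A~B) λ ())
  (λ γ~δ → contradiction γ~δ (equinumerous⇒¬Comparable γ δ (trans p (sym q))))
move⇔Comparable (inside ∷ γ , p) (outside ∷ δ , q) = exchange⇔Comparable γ δ p q
move⇔Comparable {n} {j} A@(outside ∷ γ , p) B@(inside ∷ δ , q) = mk⇔
  -- The mirror case follows from the symmetry of both relations.
  (swap ∘ to ∘ Adj-sym (starTokenGraph n j) {A} {B})
  (Adj-sym (starTokenGraph n j) {B} {A} ∘ from ∘ swap)
  where open Equivalence (exchange⇔Comparable δ γ q p)

mainTheorem6 : (k : ℕ) → 1 ≤ k → tokenGraph k (completeBipartite 1 (2 * k ∸ 1)) ≅ doubleOddGraph k
-- On `suc j` the truncated subtractions reduce, and the vertices of `doubleOddGraph (suc j)` become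
-- `Layers` by computation, with adjacency `Comparable`.
mainTheorem6 (suc j) _ = record
  { vertices  = KSubset↔Layers
  ; adjacency = move⇔Comparable
  }
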